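{- Let $D$ be a strong symmetric digraph of order $n$ and $k$ an integer with $2\le k\le n$. Then $\lambda_k(D)\ge 2$ if and only if $D$ has no bridge.
   Context: A digraph $D$ is symmetric if for every arc $xy$, $yx$ is also an arc. A 2-cycle $xyx$ of a strong digraph $D$ is a bridge if $D-\{xy,yx\}$ is disconnected (i.e., its underlying graph is disconnected). For $S\subseteq V(D)$, $\lambda_S(D)$ is the maximum number of pairwise arc-disjoint strong subgraphs of $D$ containing $S$, and $\lambda_k(D)=\min\{\lambda_S(D): S\subseteq V(D), |S|=k\}$. -}

module Defs where

open import Data.Bool.Base using (true; false)
open import Data.Empty using (⊥-elim)
open import Data.Fin.Base using (Fin; zero; suc; combine)
open import Data.Fin.Properties using (all?; combine-injective; injective⇒≤; suc-injective) renaming (_≟_ to _≟ᶠ_)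
open import Data.Fin.Subset using (Subset; inside; outside; _∈_; _⊆_; ∣_∣)
open import Data.Fin.Subset.Properties using (_∈?_; _⊆?_)
open import Data.List.Base using (List; []; _∷_; map; filter; upTo; allFin; cartesianProductWith)
open import Data.List.Extrema.Nat using (min; max; argmin-sel; argmax-sel; min≤v⁺; v≤max⁺; max≤v⁺)
open import Data.List.Membership.Propositional using (find; lose) renaming (_∈_ to _∈ˡ_)
open import Data.List.Membership.Propositional.Properties using (∈-cartesianProductWith⁺; ∈-allFin; ∈-upTo⁺; ∈-upTo⁻; ∈-filter⁺; ∈-filter⁻; ∈-map⁺; ∈-map⁻)
import Data.List.Relation.Unary.All as All
open import Data.List.Relation.Unary.Any as Any using (here; there)
open import Data.Nat.Base using (ℕ; zero; suc; _*_; _≤_; z≤n; s≤s; s≤s⁻¹)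
open import Data.Nat.Properties using (_≟_; ≤-antisym; ≤-refl)
open import Data.Product.Base using (∃; ∃₂; _×_; _,_; proj₁; proj₂)
open import Data.Sum.Base using (_⊎_; inj₁; inj₂)
open import Data.Vec.Base using (Vec; []; _∷_; lookup; here; there)
open import Function.Base using (_∘_)
open import Level using (0ℓ)
open import Relation.Binary.Construct.Closure.Equivalence using (EqClosure)
open import Relation.Binary.Construct.Closure.ReflexiveTransitive using (Star; ε; _◅_; _◅◅_)
open import Relation.Binary.Core using (Rel)
open import Relation.Binary.Definitions using (Decidable)
open import Relation.Binary.PropositionalEquality using (_≡_; _≢_; refl; sym; cong; subst)
open import Relation.Nullary using (¬_; yes; no)
open import Relation.Nullary.Decidable using (map′; _×-dec_; _⊎-dec_; _→-dec_; ¬?)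
import Relation.Binary.Definitions as B
import Relation.Unary as U

private variable
  n : ℕ

-- Finite digraphs of order n, without loops or parallel arcs.
record Digraph (n : ℕ) : Set₁ where
  infix 4 _⟶_ _⟶?_
  field
    _⟶_      : Rel (Fin n) 0ℓ
    _⟶?_     : Decidable _⟶_
    loopless : ∀ u → ¬ (u ⟶ u)

Strong : Digraph n → Set
Strong D = ∀ u v → Star _⟶_ u v
  where open Digraph D

Symmetric : Digraph n → Set
Symmetric D = B.Symmetric (Digraph._⟶_ D)

-- Connectedness of the underlying undirected graph of the arc relation R:
-- EqClosure R is reachability along arcs traversed in either direction.
Connected : Rel (Fin n) 0ℓ → Set
Connected R = ∀ u v → EqClosure R u v

-- The arcs of D − {xy, yx}.
Delete2Cycle : Digraph n → Fin n → Fin n → Rel (Fin n) 0ℓ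
Delete2Cycle D x y u v = u ⟶ v × ¬ (u ≡ x × v ≡ y) × ¬ (u ≡ y × v ≡ x)
  where open Digraph D

IsBridge : Digraph n → Fin n → Fin n → Set
IsBridge D x y = x ⟶ y × y ⟶ x × ¬ Connected (Delete2Cycle D x y)
  where open Digraph D

HasBridge : Digraph n → Set
HasBridge D = ∃₂ λ x y → IsBridge D x y

-- A candidate subgraph: a vertex set, and for each u the set of heads of the
-- arcs leaving u.
record Sub (n : ℕ) : Set where
  constructor mkSub
  field
    verts : Subset n
    heads : Vec (Subset n) n

  Arc : Rel (Fin n) 0ℓ
  Arc u v = v ∈ lookup heads u

open Sub public

IsSubgraph : Digraph n → Sub n → Set
IsSubgraph D H = ∀ u v → Arc H u v → u ⟶ v × u ∈ verts H × v ∈ verts H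
  where open Digraph D

StrongSub : Sub n → Set
StrongSub H = ∀ u v → u ∈ verts H → v ∈ verts H → Star (Arc H) u v

IsStrongSubgraphContaining : Digraph n → Subset n → Sub n → Set
IsStrongSubgraphContaining D S H = IsSubgraph D H × StrongSub H × S ⊆ verts H

ArcDisjoint : Sub n → Sub n → Set
ArcDisjoint H K = ∀ u v → ¬ (Arc H u v × Arc K u v)

IsPacking : Digraph n → Subset n → ∀ {m} → Vec (Sub n) m → Set
IsPacking D S Hs =
  (∀ i → IsStrongSubgraphContaining D S (lookup Hs i)) ×
  (∀ i j → i ≢ j → ArcDisjoint (lookup Hs i) (lookup Hs j))

Packable : Digraph n → Subset n → ℕ → Set
Packable {n} D S m = ∃ λ (Hs : Vec (Sub n) m) → IsPacking D S Hs

module _ {R : Rel (Fin n) 0ℓ} (R? : Decidable R) where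
  private
    -- Warshall: paths from u to v with all inner vertices in the list.
    Via : List (Fin n) → Rel (Fin n) 0ℓ
    Via []       u v = u ≡ v ⊎ R u v
    Via (w ∷ ws) u v = Via ws u v ⊎ (Via ws u w × Via ws w v)

    via? : ∀ ws → Decidable (Via ws)
    via? []       u v = (u ≟ᶠ v) ⊎-dec R? u v
    via? (w ∷ ws) u v = via? ws u v ⊎-dec (via? ws u w ×-dec via? ws w v)

    via-base : ∀ ws {u v} → u ≡ v ⊎ R u v → Via ws u v
    via-base []       p = p
    via-base (w ∷ ws) p = inj₁ (via-base ws p)

    via⇒star : ∀ ws {u v} → Via ws u v → Star R u v
    via⇒star []       (inj₁ refl)    = ε
    via⇒star []       (inj₂ r)       = r ◅ ε
    via⇒star (w ∷ ws) (inj₁ p)       = via⇒star ws p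
    via⇒star (w ∷ ws) (inj₂ (p , q)) = via⇒star ws p ◅◅ via⇒star ws q

    via-trans : ∀ {ws x u v} → x ∈ˡ ws → Via ws u x → Via ws x v → Via ws u v
    via-trans {w ∷ ws} {x} {u} {v} (here refl) p q = inj₂ (left p , right q)
      where
      left : Via (w ∷ ws) u w → Via ws u w
      left (inj₁ a)       = a
      left (inj₂ (a , _)) = a
      right : Via (w ∷ ws) w v → Via ws w v
      right (inj₁ a)       = a
      right (inj₂ (_ , a)) = a
    via-trans (there x∈) (inj₁ p)       (inj₁ q)       = inj₁ (via-trans x∈ p q)
    via-trans (there x∈) (inj₁ p)       (inj₂ (q , r)) = inj₂ (via-trans x∈ p q , r)
    via-trans (there x∈) (inj₂ (p , q)) (inj₁ r)       = inj₂ (p , via-trans x∈ q r)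
    via-trans (there x∈) (inj₂ (p , _)) (inj₂ (_ , q)) = inj₂ (p , q)

    star⇒via : ∀ {u v} → Star R u v → Via (allFin n) u v
    star⇒via ε        = via-base (allFin n) (inj₁ refl)
    star⇒via (r ◅ rs) =
      via-trans (∈-allFin _) (via-base (allFin n) (inj₂ r)) (star⇒via rs)

  star? : Decidable (Star R)
  star? u v = map′ (via⇒star (allFin n)) star⇒via (via? (allFin n) u v)

allVecs : ∀ {A : Set} → List A → ∀ m → List (Vec A m)
allVecs xs zero    = [] ∷ []
allVecs xs (suc m) = cartesianProductWith _∷_ xs (allVecs xs m)

∈-allVecs : ∀ {A : Set} {xs : List A} → (∀ x → x ∈ˡ xs) →
            ∀ {m} (v : Vec A m) → v ∈ˡ allVecs xs m
∈-allVecs all []      = here refl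
∈-allVecs all (x ∷ v) = ∈-cartesianProductWith⁺ _∷_ (all x) (∈-allVecs all v)

allSubsets : ∀ n → List (Subset n)
allSubsets = allVecs (outside ∷ inside ∷ [])

∈-allSubsets : (S : Subset n) → S ∈ˡ allSubsets n
∈-allSubsets = ∈-allVecs λ where
  false → here refl
  true  → there (here refl)

allSubs : ∀ n → List (Sub n)
allSubs n = cartesianProductWith mkSub (allSubsets n) (allVecs (allSubsets n) n)

∈-allSubs : (H : Sub n) → H ∈ˡ allSubs n
∈-allSubs (mkSub V A) =
  ∈-cartesianProductWith⁺ mkSub (∈-allSubsets V) (∈-allVecs ∈-allSubsets A)

module _ (D : Digraph n) (S : Subset n) where
  open Digraph D

  arc? : (H : Sub n) → Decidable (Arc H)
  arc? H u v = v ∈? lookup (heads H) u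

  isStrongSubgraphContaining? : U.Decidable (IsStrongSubgraphContaining D S)
  isStrongSubgraphContaining? H =
    (all? λ u → all? λ v →
      arc? H u v →-dec ((u ⟶? v) ×-dec (u ∈? verts H) ×-dec (v ∈? verts H)))
    ×-dec
    (all? λ u → all? λ v →
      (u ∈? verts H) →-dec ((v ∈? verts H) →-dec star? (arc? H) u v))
    ×-dec
    (S ⊆? verts H)

  isPacking? : ∀ {m} → U.Decidable (IsPacking D S {m})
  isPacking? Hs =
    (all? λ i → isStrongSubgraphContaining? (lookup Hs i))
    ×-dec
    (all? λ i → all? λ j → ¬? (i ≟ᶠ j) →-dec
      (all? λ u → all? λ v →
        ¬? (arc? (lookup Hs i) u v ×-dec arc? (lookup Hs j) u v)))

  -- Only a decision procedure; abstract so that it is never unfolded.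
  abstract
    packable? : U.Decidable (Packable D S)
    packable? m = map′
      (λ any → let Hs , _ , p = find any in Hs , p)
      (λ (Hs , p) → lose (∈-allVecs ∈-allSubs Hs) p)
      (Any.any? isPacking? (allVecs (allSubs n) m))

-- The cut-off n * n loses nothing when ∣ S ∣ ≥ 2, since each member of a
-- packing then owns an arc (see λₛ-isMax).  For ∣ S ∣ ≤ 1 there is no maximum
-- and the value is meaningless.
λₛ : Digraph n → Subset n → ℕ
λₛ {n} D S = max 0 (filter (packable? D S) (upTo (suc (n * n))))

-- The first argument of min is an upper bound of all λₛ D S, so it does not
-- affect the minimum when k ≤ n (see λₖ-isMin).
λₖ : ℕ → Digraph n → ℕ
λₖ {n} k D = min (n * n) (map (λₛ D) (filter (λ S → ∣ S ∣ ≟ k) (allSubsets n)))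

private
  one : (p : Subset n) → 1 ≤ ∣ p ∣ → ∃ λ x → x ∈ p
  one (inside  ∷ p) _ = zero , here
  one (outside ∷ p) h = let x , x∈ = one p h in suc x , there x∈

  two : (p : Subset n) → 2 ≤ ∣ p ∣ → ∃₂ λ x y → x ∈ p × y ∈ p × x ≢ y
  two (inside  ∷ p) (s≤s h) =
    let y , y∈ = one p h in zero , suc y , here , there y∈ , λ ()
  two (outside ∷ p) h =
    let x , y , x∈ , y∈ , x≢y = two p h
    in suc x , suc y , there x∈ , there y∈ , x≢y ∘ suc-injective

  firstArc : {R : Rel (Fin n) 0ℓ} {x y : Fin n} → Star R x y → x ≢ y → ∃₂ R
  firstArc ε       x≢y = ⊥-elim (x≢y refl)
  firstArc (r ◅ _) _   = _ , _ , r

  max-preserves : (P : ℕ → Set) (xs : List ℕ) → P 0 →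
                  (∀ m → m ∈ˡ xs → P m) → P (max 0 xs)
  max-preserves P xs p0 ps with argmax-sel (λ m → m) 0 xs
  ... | inj₁ e  = subst P (sym e) p0
  ... | inj₂ m∈ = ps _ m∈

  min-attained : {A : Set} (f : A → ℕ) (b : ℕ) → (∀ x → f x ≤ b) →
                 ∀ xs {y} → y ∈ˡ xs →
                 ∃ λ x → x ∈ˡ xs × min b (map f xs) ≡ f x
  min-attained f b f≤b xs {y} y∈ with argmin-sel (λ m → m) b (map f xs)
  ... | inj₁ e  = y , y∈ , ≤-antisym
    (min≤v⁺ b (map f xs) (inj₂ (lose (∈-map⁺ f y∈) ≤-refl)))
    (subst (f y ≤_) (sym e) (f≤b y))
  ... | inj₂ l∈ = ∈-map⁻ f l∈

  subsetOfSize : ∀ {k n} → k ≤ n → ∃ λ (S : Subset n) → ∣ S ∣ ≡ k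
  subsetOfSize {n = zero}  z≤n     = [] , refl
  subsetOfSize {n = suc n} z≤n     = let S , e = subsetOfSize {n = n} z≤n in outside ∷ S , e
  subsetOfSize             (s≤s h) = let S , e = subsetOfSize h in inside ∷ S , cong suc e

module _ (D : Digraph n) (S : Subset n) where

  packable⇒≤ : 2 ≤ ∣ S ∣ → ∀ {m} → Packable D S m → m ≤ n * n
  packable⇒≤ 2≤S {m} (Hs , strong , disj) = injective⇒≤ inj
    where
    arcOf : ∀ i → ∃₂ (Arc (lookup Hs i))
    arcOf i =
      let x , y , x∈ , y∈ , x≢y = two S 2≤S
          _ , str , S⊆ = strong i
      in firstArc (str x y (S⊆ x∈) (S⊆ y∈)) x≢y
    code : Fin m → Fin (n * n)
    code i = let u , v , _ = arcOf i in combine u v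
    inj : ∀ {i j} → code i ≡ code j → i ≡ j
    inj {i} {j} e with i ≟ᶠ j
    ... | yes i≡j = i≡j
    ... | no  i≢j with arcOf i | arcOf j
    ...   | u , v , a | u′ , v′ , b with combine-injective u v u′ v′ e
    ...     | refl , refl = ⊥-elim (disj i j i≢j u v (a , b))

  λₛ≤n*n : λₛ D S ≤ n * n
  λₛ≤n*n = max≤v⁺ {xs = filter (packable? D S) (upTo (suc (n * n)))} z≤n
    (All.tabulate λ x∈ → s≤s⁻¹ (∈-upTo⁻ (proj₁ (∈-filter⁻ (packable? D S) x∈))))

  λₛ-isMax : 2 ≤ ∣ S ∣ →
             Packable D S (λₛ D S) × (∀ m → Packable D S m → m ≤ λₛ D S)
  λₛ-isMax 2≤S =
    max-preserves (Packable D S) ms ([] , (λ ()) , λ ())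
      (λ m m∈ → proj₂ (∈-filter⁻ (packable? D S) {xs = upTo (suc (n * n))} m∈)) ,
    λ m p → v≤max⁺ 0 ms (inj₂ (lose
      (∈-filter⁺ (packable? D S) (∈-upTo⁺ (s≤s (packable⇒≤ 2≤S p))) p) ≤-refl))
    where
    ms = filter (packable? D S) (upTo (suc (n * n)))

λₖ-isMin : ∀ {k} (D : Digraph n) → k ≤ n →
           (∃ λ S → ∣ S ∣ ≡ k × λₖ k D ≡ λₛ D S) ×
           (∀ S → ∣ S ∣ ≡ k → λₖ k D ≤ λₛ D S)
λₖ-isMin {n} {k} D k≤n =
  let S , e = subsetOfSize k≤n
      T , T∈ , eq = min-attained (λₛ D) (n * n) (λ S → λₛ≤n*n D S) Ss (∈-Ss S e)
  in (T , proj₂ (∈-filter⁻ size? {xs = allSubsets n} T∈) , eq) ,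
     λ S e → min≤v⁺ (n * n) (map (λₛ D) Ss)
       (inj₂ (lose (∈-map⁺ (λₛ D) (∈-Ss S e)) ≤-refl))
  where
  size? : U.Decidable (λ (S : Subset n) → ∣ S ∣ ≡ k)
  size? S = ∣ S ∣ ≟ k
  Ss = filter size? (allSubsets n)
  ∈-Ss : ∀ S → ∣ S ∣ ≡ k → S ∈ˡ Ss
  ∈-Ss S e = ∈-filter⁺ size? (∈-allSubsets S) e

{-# OPTIONS --safe #-}
-- If xy, yx is a bridge and S contains x and y, then of two arc-disjoint strong
-- subgraphs containing S one avoids the arc xy; its path from x to y, cut at the
-- first visit of y, also avoids yx, so D − {xy, yx} is connected after all.
--
-- Conversely, a bridgeless connected graph has a strong orientation (Robbins),
-- and this orientation and its reverse are arc-disjoint spanning strong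
-- subgraphs of a symmetric D.  The orientation is reached by visiting the
-- 2-cycles one at a time and deleting one of the two arcs so that the digraph
-- stays strong (Boesch and Tindell).
module Submission where

open import Defs
open import Data.Bool.Base using (true)
open import Data.Empty using (⊥; ⊥-elim)
open import Data.Fin.Base using (Fin; zero; suc)
open import Data.Fin.Properties using (_≟_)
open import Data.Fin.Subset using (Subset; inside; outside; ⊤; ⁅_⁆; _∈_; _⊆_; _∪_; ∣_∣)
open import Data.Fin.Subset.Properties using (∈⊤; ⊆⊤; ∣⊤∣≡n; ∣⁅x⁆∣≡1; x∈⁅x⁆; p⊆p∪q; q⊆p∪q; s⊆s)
open import Data.List.Base using (List; []; _∷_; allFin; cartesianProduct)
open import Data.List.Membership.Propositional using () renaming (_∈_ to _∈ˡ_)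
open import Data.List.Membership.Propositional.Properties using (∈-allFin; ∈-cartesianProduct⁺)
open import Data.List.Relation.Unary.Any using (here; there)
open import Data.Nat.Base using (ℕ; suc; _+_; _≤_; s≤s; z≤n)
open import Data.Nat.Properties using (≤-trans; ≤-reflexive; +-suc; +-monoʳ-≤; n≤1+n; m≤n⇒m<n∨m≡n)
open import Data.Product.Base using (∃; _×_; _,_; proj₁; proj₂; curry; swap)
open import Data.Sum.Base as Sum using (_⊎_; inj₁; inj₂; [_,_]′)
open import Data.Vec.Base using ([]; _∷_; lookup; tabulate)
open import Data.Vec.Properties using (lookup∘tabulate; []=⇒lookup; lookup⇒[]=)
open import Function.Base using (_∘_; id; flip)
open import Function.Bundles using (_⇔_; mk⇔)
open import Level using (0ℓ)
open import Relation.Binary.Construct.Closure.Equivalence using (EqClosure; symmetric) renaming (_⋆ to _⋆ᵉ)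
open import Relation.Binary.Construct.Closure.ReflexiveTransitive as Star using (Star; ε; _◅_; _◅◅_; _⋆)
open import Relation.Binary.Construct.Closure.Symmetric using (fwd; bwd)
open import Relation.Binary.Core using (Rel; _⇒_)
open import Relation.Binary.Definitions using (Decidable)
open import Relation.Binary.PropositionalEquality using (_≡_; _≢_; refl; sym; trans; cong)
open import Relation.Nullary using (¬_; Dec; yes; no; does; contradiction)
open import Relation.Nullary.Decidable using (_×-dec_; ¬?; dec-true)

private variable
  n k : ℕ

-- Sets of size `k` through two given vertices.

∣p∪q∣≤∣p∣+∣q∣ : (p q : Subset n) → ∣ p ∪ q ∣ ≤ ∣ p ∣ + ∣ q ∣
∣p∪q∣≤∣p∣+∣q∣ []            []            = z≤n
∣p∪q∣≤∣p∣+∣q∣ (outside ∷ p) (outside ∷ q) = ∣p∪q∣≤∣p∣+∣q∣ p q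
∣p∪q∣≤∣p∣+∣q∣ (outside ∷ p) (inside ∷ q)  =
  ≤-trans (s≤s (∣p∪q∣≤∣p∣+∣q∣ p q)) (≤-reflexive (sym (+-suc ∣ p ∣ ∣ q ∣)))
∣p∪q∣≤∣p∣+∣q∣ (inside ∷ p)  (outside ∷ q) = s≤s (∣p∪q∣≤∣p∣+∣q∣ p q)
∣p∪q∣≤∣p∣+∣q∣ (inside ∷ p)  (inside ∷ q)  =
  s≤s (≤-trans (∣p∪q∣≤∣p∣+∣q∣ p q) (+-monoʳ-≤ ∣ p ∣ (n≤1+n ∣ q ∣)))

enlarge : (p : Subset n) → ∣ p ∣ ≤ k → k ≤ n → ∃ λ q → p ⊆ q × ∣ q ∣ ≡ k
enlarge []            _       z≤n       = [] , id , refl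
enlarge (inside ∷ p)  (s≤s h) (s≤s k≤n) =
  let q , p⊆q , e = enlarge p h k≤n in inside ∷ q , s⊆s p⊆q , cong suc e
-- The head may stay outside only while `k ≤ n`; otherwise `k` is the full length and `⊤` is forced.
enlarge (outside ∷ p) h       k≤1+n with m≤n⇒m<n∨m≡n k≤1+n
... | inj₁ (s≤s k≤n) =
  let q , p⊆q , e = enlarge p h k≤n in outside ∷ q , s⊆s p⊆q , e
... | inj₂ refl      = ⊤ , ⊆⊤ , ∣⊤∣≡n _

subsetOfSizeThrough : ∀ (x y : Fin n) → 2 ≤ k → k ≤ n →
                      ∃ λ S → x ∈ S × y ∈ S × ∣ S ∣ ≡ k
subsetOfSizeThrough x y 2≤k k≤n =
  let S , ⊆S , e = enlarge (⁅ x ⁆ ∪ ⁅ y ⁆) (≤-trans small 2≤k) k≤n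
  in S , ⊆S (p⊆p∪q ⁅ y ⁆ (x∈⁅x⁆ x)) , ⊆S (q⊆p∪q ⁅ x ⁆ ⁅ y ⁆ (x∈⁅x⁆ y)) , e
  where
  small : ∣ ⁅ x ⁆ ∪ ⁅ y ⁆ ∣ ≤ 2
  small with ∣p∪q∣≤∣p∣+∣q∣ ⁅ x ⁆ ⁅ y ⁆
  ... | h rewrite ∣⁅x⁆∣≡1 x | ∣⁅x⁆∣≡1 y = h

-- Two arc-disjoint subgraphs exclude a bridge.

data ArcCase (D : Digraph n) (x y : Fin n) : Rel (Fin n) 0ℓ where
  is-xy : ArcCase D x y x y
  is-yx : ArcCase D x y y x
  other : ∀ {u v} → Delete2Cycle D x y u v → ArcCase D x y u v

arcCase : ∀ (D : Digraph n) x y → Digraph._⟶_ D ⇒ ArcCase D x y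
arcCase D x y {u} {v} uv
  with (u ≟ x) ×-dec (v ≟ y) | (u ≟ y) ×-dec (v ≟ x)
... | yes (refl , refl) | _                 = is-xy
... | no _              | yes (refl , refl) = is-yx
... | no ≢xy            | no ≢yx            = other (uv , ≢xy , ≢yx)

-- Walks of `D` are rerouted: `xy` along the given path, `yx` along its reverse.
linked⇒connected : ∀ (D : Digraph n) {x y} → Strong D →
                   EqClosure (Delete2Cycle D x y) x y →
                   Connected (Delete2Cycle D x y)
linked⇒connected D {x} {y} strong path u v = (detour ⋆) (strong u v)
  where
  detour : Digraph._⟶_ D ⇒ EqClosure (Delete2Cycle D x y)
  detour uv with arcCase D x y uv
  ... | is-xy   = path
  ... | is-yx   = symmetric _ path
  ... | other r = fwd r ◅ ε

cutAtTarget : ∀ (D : Digraph n) {R : Rel (Fin n) 0ℓ} {x y} →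
              R ⇒ Digraph._⟶_ D → ¬ R x y →
              ∀ {u} → Star R u y → Star (Delete2Cycle D x y) u y
cutAtTarget D R⊆D ¬xy ε = ε
cutAtTarget D {x = x} {y} R⊆D ¬xy {u} (r ◅ rs) with u ≟ y
... | yes refl = ε
... | no u≢y   =
  -- `¬xy` excludes the arc `xy`; `yx` is excluded because it would leave `y`.
  (R⊆D r , (λ { (refl , refl) → ¬xy r }) , u≢y ∘ proj₁) ◅ cutAtTarget D R⊆D ¬xy rs

avoidingSub⇒connected : ∀ (D : Digraph n) {S H x y} → Strong D → x ∈ S → y ∈ S →
                        IsStrongSubgraphContaining D S H → ¬ Arc H x y →
                        Connected (Delete2Cycle D x y)
avoidingSub⇒connected D strong x∈S y∈S (sub , str , S⊆) ¬xy =
  linked⇒connected D strong (Star.map fwd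
    (cutAtTarget D (proj₁ ∘ sub _ _) ¬xy (str _ _ (S⊆ x∈S) (S⊆ y∈S))))

-- At most one of the first two members owns the arc `xy`; the other links `x` to `y`.
packable₂⇒noBridge : ∀ (D : Digraph n) {S x y m} → Strong D → x ∈ S → y ∈ S →
                     2 ≤ m → Packable D S m → ¬ IsBridge D x y
packable₂⇒noBridge D {S} {x} {y} strong x∈S y∈S (s≤s (s≤s _))
                   (H ∷ K ∷ _ , isSub , disjoint) (_ , _ , disconnected)
  with arc? D S H x y
... | no ¬xy = disconnected
  (avoidingSub⇒connected D {H = H} strong x∈S y∈S (isSub zero) ¬xy)
... | yes xy = disconnected
  (avoidingSub⇒connected D {H = K} strong x∈S y∈S (isSub (suc zero))
    (λ xy′ → disjoint zero (suc zero) (λ ()) x y (xy , xy′)))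

-- Deleting one arc of a 2-cycle.

deleteArc : Digraph n → Fin n → Fin n → Digraph n
deleteArc G x y = record
  { _⟶_      = λ u v → u ⟶ v × ¬ (u ≡ x × v ≡ y)
  ; _⟶?_     = λ u v → (u ⟶? v) ×-dec ¬? ((u ≟ x) ×-dec (v ≟ y))
  ; loopless = λ u → loopless u ∘ proj₁
  }
  where open Digraph G

deleteArc-strong : ∀ (G : Digraph n) {x y} → Strong G →
                   Star (Digraph._⟶_ (deleteArc G x y)) x y →
                   Strong (deleteArc G x y)
deleteArc-strong G {x} {y} strong path u v = (detour ⋆) (strong u v)
  where
  detour : Digraph._⟶_ G ⇒ Star (Digraph._⟶_ (deleteArc G x y))
  detour {u} {v} r with (u ≟ x) ×-dec (v ≟ y)
  ... | yes (refl , refl) = path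
  ... | no ≢xy            = (r , ≢xy) ◅ ε

module _ (G : Digraph n) (strong : Strong G) (x y : Fin n) where
  open Digraph G
  private
    R : Rel (Fin n) 0ℓ
    R = Delete2Cycle G x y

    R? : Decidable R
    R? u v = (u ⟶? v) ×-dec ¬? ((u ≟ x) ×-dec (v ≟ y)) ×-dec ¬? ((u ≟ y) ×-dec (v ≟ x))

    -- Only what follows the last use of the 2-cycle is kept; it starts at `x` or `y`.
    reached : ∀ {u w} → Star _⟶_ u w → Star R u w ⊎ Star R x w ⊎ Star R y w
    reached ε        = inj₁ ε
    reached (r ◅ rs) with reached rs
    ... | inj₂ p = inj₂ p
    ... | inj₁ p with arcCase G x y r
    ...   | is-xy   = inj₂ (inj₂ p)
    ...   | is-yx   = inj₂ (inj₁ p)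
    ...   | other r = inj₁ (r ◅ p)

    fromEnd : ∀ w → Star R x w ⊎ Star R y w
    fromEnd w = [ inj₁ , id ]′ (reached (strong x w))

    -- Dually, the walk is cut just before its first use of the 2-cycle.
    toEnd : ∀ {w} → Star _⟶_ w x → Star R w x ⊎ Star R w y
    toEnd ε        = inj₁ ε
    toEnd (r ◅ rs) with arcCase G x y r
    ... | is-xy   = inj₁ ε
    ... | is-yx   = inj₂ ε
    ... | other r = Sum.map (r ◅_) (r ◅_) (toEnd rs)

  -- If neither end reaches the other without the 2-cycle, the vertices reached
  -- from x and those reached from y partition the digraph, and no remaining
  -- arc joins the two parts.
  separated⇒disconnected : ¬ Star R x y → ¬ Star R y x → ¬ Connected R
  separated⇒disconnected x↛y y↛x connected = x↛y (stays (connected x y) ε)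
    where
    disjoint : ∀ {w} → Star R x w → Star R y w → ⊥
    -- From a common vertex `w`, `toEnd` leads to an end inside `R`, so one end would reach the
    -- other through `w`.
    disjoint {w} p q = [ y↛x ∘ (q ◅◅_) , x↛y ∘ (p ◅◅_) ]′ (toEnd (strong w x))

    stays : ∀ {u w} → EqClosure R u w → Star R x u → Star R x w
    stays ε            p = p
    stays (fwd r ◅ rs) p = stays rs (p ◅◅ r ◅ ε)
    -- The arc leads from `v` to the current vertex; were `v` reached from `y`, the current vertex
    -- would lie in both parts.
    stays (_◅_ {j = v} (bwd r) rs) p with fromEnd v
    ... | inj₁ q = stays rs q
    ... | inj₂ q = ⊥-elim (disjoint p (q ◅◅ r ◅ ε))

  -- Absence of a bridge yields only this double negation. It suffices: `star?` decides both
  -- directions, and connectedness just refutes the case where both fail.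
  strongWithoutOneArc : ¬ ¬ Connected R →
                        Strong (deleteArc G x y) ⊎ Strong (deleteArc G y x)
  strongWithoutOneArc connected with star? R? x y | star? R? y x
  ... | yes p | _     = inj₁ (deleteArc-strong G strong
                          (Star.map (λ (s , ≢xy , _) → s , ≢xy) p))
  ... | no _  | yes p = inj₂ (deleteArc-strong G strong
                          (Star.map (λ (s , _ , ≢yx) → s , ≢yx) p))
  ... | no ¬p | no ¬q = ⊥-elim (connected (separated⇒disconnected ¬p ¬q))

-- Orienting the 2-cycles one by one.

-- The loop invariant, with `ps` the pairs already visited. `sound` and `covers` together fix the
-- underlying undirected graph.
record PartialOrientation (D : Digraph n) (ps : List (Fin n × Fin n)) : Set₁ where
  field
    graph    : Digraph n
    strong   : Strong graph
    sound    : Digraph._⟶_ graph ⇒ Digraph._⟶_ D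
    covers   : ∀ {u v} → Digraph._⟶_ D u v →
               Digraph._⟶_ graph u v ⊎ Digraph._⟶_ graph v u
    oriented : ∀ {x y} → (x , y) ∈ˡ ps →
               ¬ (Digraph._⟶_ graph x y × Digraph._⟶_ graph y x)

module _ (D : Digraph n) where
  open Digraph D using (_⟶_)
  open PartialOrientation

  dropArc : ∀ {ps} (O : PartialOrientation D ps) x y →
            Digraph._⟶_ (graph O) y x → x ≢ y → Strong (deleteArc (graph O) x y) →
            PartialOrientation D ((x , y) ∷ ps)
  dropArc O x y yx x≢y strong′ = record
    { graph    = deleteArc (graph O) x y
    ; strong   = strong′
    ; sound    = sound O ∘ proj₁
    ; covers   = λ uv → [ keep , Sum.swap ∘ keep ]′ (covers O uv)
    ; oriented = λ where
        (here refl) ((_ , ≢xy) , _)       → ≢xy (refl , refl)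
        (there ∈ps) ((uv , _) , (vu , _)) → oriented O ∈ps (uv , vu)
    }
    where
    _⟶′_ = Digraph._⟶_ (deleteArc (graph O) x y)

    keep : ∀ {u v} → Digraph._⟶_ (graph O) u v → (u ⟶′ v) ⊎ (v ⟶′ u)
    keep {u} {v} uv with (u ≟ x) ×-dec (v ≟ y)
    -- The deleted arc remains covered by its reverse, a different arc since `x≢y`.
    ... | yes (refl , refl) = inj₂ (yx , x≢y ∘ sym ∘ proj₁)
    ... | no ≢xy            = inj₁ (uv , ≢xy)

  module _ (strongD : Strong D) (noBridge : ¬ HasBridge D) where

    orientStep : ∀ {ps} (p : Fin n × Fin n) → PartialOrientation D ps →
                 PartialOrientation D (p ∷ ps)
    orientStep {ps} (x , y) O with (x ⟶? y) ×-dec (y ⟶? x)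
      where open Digraph (graph O) using (_⟶?_)
    ... | no ¬both = record
      { PartialOrientation O
      ; oriented = λ { (here refl) → ¬both ; (there ∈ps) → oriented O ∈ps }
      }
    ... | yes (xy , yx) =
      [ dropArc O x y yx x≢y , swapHead ∘ dropArc O y x xy (x≢y ∘ sym) ]′
        -- A bridge of the partial orientation would be a bridge of `D`.
        (strongWithoutOneArc (graph O) (strong O) x y λ disconnected →
          noBridge (x , y , sound O xy , sound O yx , disconnected ∘ transfer))
      where
      x≢y : x ≢ y
      x≢y refl = Digraph.loopless D x (sound O xy)

      swapHead : PartialOrientation D ((y , x) ∷ ps) → PartialOrientation D ((x , y) ∷ ps)
      swapHead P = record
        { PartialOrientation P
        ; oriented = λ where
            (here refl) (uv , vu) → oriented P (here refl) (vu , uv)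
            (there ∈ps)           → oriented P (there ∈ps)
        }

      -- By `covers` each arc of `D` survives in some direction, and the underlying graph forgets
      -- which.
      transfer : Connected (Delete2Cycle D x y) → Connected (Delete2Cycle (graph O) x y)
      transfer connected u v = (edge ⋆ᵉ) (connected u v)
        where
        edge : Delete2Cycle D x y ⇒ EqClosure (Delete2Cycle (graph O) x y)
        edge (uv , ≢xy , ≢yx) =
          [ (λ a → fwd (a , ≢xy , ≢yx) ◅ ε)
          , (λ a → bwd (a , ≢yx ∘ swap , ≢xy ∘ swap) ◅ ε)
          ]′ (covers O uv)

    partialOrientation : ∀ ps → PartialOrientation D ps
    partialOrientation []       = record
      { graph = D ; strong = strongD ; sound = id ; covers = inj₁ ; oriented = λ () }
    partialOrientation (p ∷ ps) = orientStep p (partialOrientation ps)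

    -- Once all ordered pairs are visited, `oriented` is asymmetry.
    robbins : ∃ λ G → Strong G × Digraph._⟶_ G ⇒ _⟶_ ×
              (∀ {u v} → Digraph._⟶_ G u v → ¬ Digraph._⟶_ G v u)
    robbins = graph O , strong O , sound O ,
      curry (oriented O (∈-cartesianProduct⁺ (∈-allFin _) (∈-allFin _)))
      where O = partialOrientation (cartesianProduct (allFin n) (allFin n))

-- The packing by an orientation and its reverse.

spanning : {R : Rel (Fin n) 0ℓ} → Decidable R → Sub n
spanning R? = mkSub ⊤ (tabulate λ u → tabulate λ v → does (R? u v))

module _ {R : Rel (Fin n) 0ℓ} (R? : Decidable R) where
  private
    entry : ∀ u v → lookup (lookup (heads (spanning R?)) u) v ≡ does (R? u v)
    entry u v = trans (cong (flip lookup v) (lookup∘tabulate _ u)) (lookup∘tabulate _ v)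

  arc⁺ : R ⇒ Arc (spanning R?)
  arc⁺ {u} {v} r = lookup⇒[]= v _ (trans (entry u v) (dec-true (R? u v) r))

  arc⁻ : Arc (spanning R?) ⇒ R
  arc⁻ {u} {v} a = does-true (R? u v) (trans (sym (entry u v)) ([]=⇒lookup a))
    where
    does-true : ∀ {A : Set} (a? : Dec A) → does a? ≡ true → A
    does-true (yes a) _ = a

  spanning-strong : ∀ (D : Digraph n) S → R ⇒ Digraph._⟶_ D → (∀ u v → Star R u v) →
                    IsStrongSubgraphContaining D S (spanning R?)
  spanning-strong D S R⊆D strong =
    (λ u v a → R⊆D (arc⁻ a) , ∈⊤ , ∈⊤) ,
    (λ u v _ _ → Star.map arc⁺ (strong u v)) ,
    ⊆⊤

noBridge⇒packable₂ : ∀ (D : Digraph n) S → Strong D → Symmetric D →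
                     ¬ HasBridge D → Packable D S 2
noBridge⇒packable₂ D S strongD symD noBridge
  with G , strongG , G⊆D , asym ← robbins D strongD noBridge =
  let open Digraph G using (_⟶?_) in
  spanning _⟶?_ ∷ spanning (flip _⟶?_) ∷ [] ,
  (λ where
    zero       → spanning-strong _⟶?_ D S G⊆D strongG
    (suc zero) → spanning-strong (flip _⟶?_) D S (symD ∘ G⊆D)
                   (λ u v → Star.reverse id (strongG v u))) ,
  (λ where
    zero       zero       0≢0 → contradiction refl 0≢0
    -- A common arc would put both `uv` and `vu` in the orientation.
    zero       (suc zero) _ u v (a , b) → asym (arc⁻ _⟶?_ a) (arc⁻ (flip _⟶?_) b)
    (suc zero) zero       _ u v (a , b) → asym (arc⁻ _⟶?_ b) (arc⁻ (flip _⟶?_) a)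
    (suc zero) (suc zero) 1≢1 → contradiction refl 1≢1)

theorem4p4 : (n k : ℕ) (D : Digraph n) → Strong D → Symmetric D →
    2 ≤ k → k ≤ n → (2 ≤ λₖ k D) ⇔ (¬ HasBridge D)
theorem4p4 n k D strong sym-D 2≤k k≤n = mk⇔ to from
  where
  to : 2 ≤ λₖ k D → ¬ HasBridge D
  to 2≤λ (x , y , bridge) =
    -- `S` holds both ends of the supposed bridge. By `2≤k` the value `λₛ D S` is a true maximum, so
    -- a packing of that size, at least `λₖ k D`, exists.
    let S , x∈S , y∈S , e = subsetOfSizeThrough x y 2≤k k≤n
        packed = proj₁ (λₛ-isMax D S (≤-trans 2≤k (≤-reflexive (sym e))))
    in packable₂⇒noBridge D strong x∈S y∈S
         (≤-trans 2≤λ (proj₂ (λₖ-isMin D k≤n) S e)) packed bridge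

  from : ¬ HasBridge D → 2 ≤ λₖ k D
  from noBridge =
    -- This `S` attains the minimum, so a packing of two for it alone suffices.
    let (S , e , λₖ≡λₛ) , _ = λₖ-isMin D k≤n
        maximal = proj₂ (λₛ-isMax D S (≤-trans 2≤k (≤-reflexive (sym e))))
    in ≤-trans (maximal 2 (noBridge⇒packable₂ D S strong sym-D noBridge))
               (≤-reflexive (sym λₖ≡λₛ))
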